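{- Let $T=\{t_1,\ldots,t_N\}$ be documents, each containing at most $L$ distinct words from a dictionary $\{w_1,\ldots,w_D\}$ ($D\ge2$). For a word $w$ let $\#(w)$ be the number of documents containing $w$. Fix $\epsilon\in(0,1]$ and $p=2\log D$. Consider the mapper that, for every document $t$ and every unordered pair of distinct words $(w_1,w_2)$ in $t$, independently emits $((w_1,w_2)\to1)$ with probability $\min\!\left(1,\frac{p}{\epsilon}\frac{2}{\#(w_1)+\#(w_2)}\right)$ (DiceSampleEmit). Then the expected total number of emitted pairs (shuffle size) is $O(DL\log(D)/\epsilon)$, independently of $N$.
   Context: This sampling scheme is used to estimate the Dice similarity $\frac{2\#(x,y)}{\#(x)+\#(y)}$, where $\#(x,y)$ is the number of documents containing both $x$ and $y$. $\log$ denotes the natural logarithm. -}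

module Defs where

open import Data.Bool.Base using (Bool; true; false; if_then_else_)
open import Data.Fin.Base using (Fin)
import Data.Fin.Properties as Fin
open import Data.Fin.Subset using (Subset; ⁅_⁆; ⋃)
open import Data.Fin.Subset.Properties using (_∈?_)
open import Data.Integer.Base as ℤ using (+_; -[1+_]; +[1+_]; +≤+; +<+)
import Data.Integer.Properties as ℤ
open import Data.List.Base
  using (List; []; _∷_; [_]; _++_; map; foldr; filter; length; allFin; cartesianProduct)
open import Data.Nat.Base as ℕ using (ℕ; zero; suc; z≤n; s≤s)
import Data.Nat.Properties as ℕ
open import Data.Product.Base using (_×_; _,_; ∃-syntax)
open import Data.Rational.Base as ℚ using (ℚ; 0ℚ; 1ℚ; mkℚ; *≤*; *<*)
import Data.Rational.Properties as ℚ
import Data.Rational.Solver as ℚ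
open import Data.Rational.Unnormalised.Base as ℚᵘ using (mkℚᵘ; *≡*)
import Data.Rational.Unnormalised.Properties as ℚᵘ
open import Data.Sum.Base using (inj₁; inj₂)
open import Data.Vec.Base as Vec using (Vec)
open import Relation.Binary.PropositionalEquality
  using (_≡_; refl; sym; trans; cong; cong₂; subst; subst₂)
open import Relation.Nullary.Decidable using (_×-dec_)

open ℚ.≤-Reasoning

fromℕℚ : ℕ → ℚ
fromℕℚ n = + n ℚ./ 1

recip : ℕ → ℚ
recip k = + 1 ℚ./ suc k

sum< : ℕ → (ℕ → ℚ) → ℚ
sum< zero    f = 0ℚ
sum< (suc n) f = sum< n f ℚ.+ f n

private
  module Q = ℚ.+-*-Solver

  +-cancel : ∀ b δ → b ℚ.+ δ ℚ.- b ≡ δ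
  +-cancel = Q.solve 2 (λ b δ → b Q.:+ δ Q.:- b Q.:= δ) refl

  neg-sub : ∀ a b → ℚ.- (a ℚ.- b) ≡ b ℚ.- a
  neg-sub = Q.solve 2 (λ a b → Q.:- (a Q.:- b) Q.:= b Q.:- a) refl

  +-sub : ∀ a b → a ≡ b ℚ.+ (a ℚ.- b)
  +-sub = Q.solve 2 (λ a b → a Q.:= b Q.:+ (a Q.:- b)) refl

  sub-comm : ∀ a b → a ℚ.- b ≡ ℚ.- (b ℚ.- a)
  sub-comm = Q.solve 2 (λ a b → a Q.:- b Q.:= Q.:- (b Q.:- a)) refl

  *-swap : ∀ a b c → a ℚ.* (b ℚ.* c) ≡ (b ℚ.* a) ℚ.* c
  *-swap = Q.solve 3 (λ a b c → a Q.:* (b Q.:* c) Q.:= (b Q.:* a) Q.:* c) refl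

  sub-+ : ∀ a b c d → (a ℚ.+ b) ℚ.- (c ℚ.+ d) ≡ (a ℚ.- c) ℚ.+ (b ℚ.- d)
  sub-+ = Q.solve 4 (λ a b c d → (a Q.:+ b) Q.:- (c Q.:+ d) Q.:= (a Q.:- c) Q.:+ (b Q.:- d)) refl

  double : ∀ δ → δ ℚ.+ δ ≡ (1ℚ ℚ.+ 1ℚ) ℚ.* δ
  double = Q.solve 1 (λ δ → δ Q.:+ δ Q.:= (Q.con 1ℚ Q.:+ Q.con 1ℚ) Q.:* δ) refl

  sub-* : ∀ a b c d → a ℚ.* b ℚ.- c ℚ.* d ≡ a ℚ.* (b ℚ.- d) ℚ.+ (a ℚ.- c) ℚ.* d
  sub-* = Q.solve 4 (λ a b c d → a Q.:* b Q.:- c Q.:* d Q.:= a Q.:* (b Q.:- d) Q.:+ (a Q.:- c) Q.:* d) refl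

  factor : ∀ a b δ → a ℚ.* δ ℚ.+ δ ℚ.* b ≡ (a ℚ.+ b) ℚ.* δ
  factor = Q.solve 3 (λ a b δ → a Q.:* δ Q.:+ δ Q.:* b Q.:= (a Q.:+ b) Q.:* δ) refl

  sub-inv : ∀ x y z w → z ℚ.* (y ℚ.* w) ℚ.- w ℚ.* (x ℚ.* z) ≡ (z ℚ.* w) ℚ.* (y ℚ.- x)
  sub-inv = Q.solve 4 (λ x y z w → z Q.:* (y Q.:* w) Q.:- w Q.:* (x Q.:* z) Q.:= (z Q.:* w) Q.:* (y Q.:- x)) refl

  shift-sub : ∀ a b c → (a ℚ.- b) ℚ.+ c ≡ (a ℚ.+ c) ℚ.- b
  shift-sub = Q.solve 3 (λ a b c → (a Q.:- b) Q.:+ c Q.:= (a Q.:+ c) Q.:- b) refl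

  *-suc : ∀ a c → (a ℚ.+ 1ℚ) ℚ.* c ≡ a ℚ.* c ℚ.+ c
  *-suc = Q.solve 2 (λ a c → (a Q.:+ Q.con 1ℚ) Q.:* c Q.:= a Q.:* c Q.:+ c) refl

  telescope : ∀ x y z r → x ℚ.- (y ℚ.+ r) ≡ (z ℚ.- y) ℚ.+ ((x ℚ.- z) ℚ.- r)
  telescope = Q.solve 4 (λ x y z r → x Q.:- (y Q.:+ r) Q.:= (z Q.:- y) Q.:+ ((x Q.:- z) Q.:- r)) refl

  +-zero : ∀ a r → a ≡ a ℚ.+ (r ℚ.- r)
  +-zero = Q.solve 2 (λ a r → a Q.:= a Q.:+ (r Q.:- r)) refl

  sub-add : ∀ a b r → a ℚ.+ (b ℚ.- r) ℚ.+ r ≡ a ℚ.+ b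
  sub-add = Q.solve 3 (λ a b r → a Q.:+ (b Q.:- r) Q.:+ r Q.:= a Q.:+ b) refl

∣-∣≤ : ∀ a b {δ} → a ℚ.≤ b ℚ.+ δ → b ℚ.≤ a ℚ.+ δ → ℚ.∣ a ℚ.- b ∣ ℚ.≤ δ
∣-∣≤ a b {δ} a≤b+δ b≤a+δ with ℚ.∣p∣≡p∨∣p∣≡-p (a ℚ.- b)
... | inj₁ eq = begin
  ℚ.∣ a ℚ.- b ∣       ≡⟨ eq ⟩
  a ℚ.- b             ≤⟨ ℚ.+-monoˡ-≤ (ℚ.- b) a≤b+δ ⟩
  b ℚ.+ δ ℚ.- b       ≡⟨ +-cancel b δ ⟩
  δ                   ∎
... | inj₂ eq = begin
  ℚ.∣ a ℚ.- b ∣       ≡⟨ eq ⟩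
  ℚ.- (a ℚ.- b)       ≡⟨ neg-sub a b ⟩
  b ℚ.- a             ≤⟨ ℚ.+-monoˡ-≤ (ℚ.- a) b≤a+δ ⟩
  a ℚ.+ δ ℚ.- a       ≡⟨ +-cancel a δ ⟩
  δ                   ∎

p≤∣p∣ : ∀ p → p ℚ.≤ ℚ.∣ p ∣
p≤∣p∣ p with ℚ.≤-total 0ℚ p
... | inj₁ 0≤p = ℚ.≤-reflexive (sym (ℚ.0≤p⇒∣p∣≡p 0≤p))
... | inj₂ p≤0 = ℚ.≤-trans p≤0 (ℚ.0≤∣p∣ p)

∣-∣≤⇒≤ : ∀ a b {δ} → ℚ.∣ a ℚ.- b ∣ ℚ.≤ δ → a ℚ.≤ b ℚ.+ δ
∣-∣≤⇒≤ a b {δ} h = begin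
  a                    ≡⟨ +-sub a b ⟩
  b ℚ.+ (a ℚ.- b)      ≤⟨ ℚ.+-monoʳ-≤ b (ℚ.≤-trans (p≤∣p∣ (a ℚ.- b)) h) ⟩
  b ℚ.+ δ              ∎

∣-∣-comm : ∀ a b → ℚ.∣ a ℚ.- b ∣ ≡ ℚ.∣ b ℚ.- a ∣
∣-∣-comm a b = trans
  (cong ℚ.∣_∣ (sub-comm a b))
  (ℚ.∣-p∣≡∣p∣ (b ℚ.- a))

*-mono-≤ : ∀ {a b c d} → 0ℚ ℚ.≤ a → a ℚ.≤ b → 0ℚ ℚ.≤ c → c ℚ.≤ d → a ℚ.* c ℚ.≤ b ℚ.* d
*-mono-≤ {a} {b} {c} {d} 0≤a a≤b 0≤c c≤d = ℚ.≤-trans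
  (ℚ.*-monoʳ-≤-nonNeg c {{ℚ.nonNegative 0≤c}} a≤b)
  (ℚ.*-monoˡ-≤-nonNeg b {{ℚ.nonNegative (ℚ.≤-trans 0≤a a≤b)}} c≤d)

inv : (p : ℚ) → 0ℚ ℚ.< p → ℚ
inv p 0<p = (ℚ.1/ p) {{ℚ.>-nonZero 0<p}}

inv-inverseʳ : ∀ p (0<p : 0ℚ ℚ.< p) → p ℚ.* inv p 0<p ≡ 1ℚ
inv-inverseʳ p 0<p = ℚ.*-inverseʳ p {{ℚ.>-nonZero 0<p}}

0<inv : ∀ p (0<p : 0ℚ ℚ.< p) → 0ℚ ℚ.< inv p 0<p
0<inv p 0<p = ℚ.positive⁻¹ (inv p 0<p) {{ℚ.1/pos⇒pos p {{ℚ.positive 0<p}}}}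

0<p*q : ∀ {p q} → 0ℚ ℚ.< p → 0ℚ ℚ.< q → 0ℚ ℚ.< p ℚ.* q
0<p*q {p} {q} 0<p 0<q =
  subst (ℚ._< p ℚ.* q) (ℚ.*-zeroʳ p) (ℚ.*-monoʳ-<-pos p {{ℚ.positive 0<p}} 0<q)

0<p+q : ∀ {p q} → 0ℚ ℚ.< p → 0ℚ ℚ.< q → 0ℚ ℚ.< p ℚ.+ q
0<p+q {p} {q} 0<p 0<q = subst (ℚ._< p ℚ.+ q) (ℚ.+-identityʳ 0ℚ) (ℚ.+-mono-< 0<p 0<q)

inv-anti-≤ : ∀ {p q} (0<p : 0ℚ ℚ.< p) (0<q : 0ℚ ℚ.< q) → p ℚ.≤ q → inv q 0<q ℚ.≤ inv p 0<p
inv-anti-≤ {p} {q} 0<p 0<q p≤q = begin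
  q⁻¹                    ≡⟨ ℚ.*-identityʳ q⁻¹ ⟨
  q⁻¹ ℚ.* 1ℚ             ≡⟨ cong (q⁻¹ ℚ.*_) (inv-inverseʳ p 0<p) ⟨
  q⁻¹ ℚ.* (p ℚ.* p⁻¹)    ≤⟨ ℚ.*-monoˡ-≤-nonNeg q⁻¹ {{ℚ.nonNegative (ℚ.<⇒≤ (0<inv q 0<q))}}
                              (ℚ.*-monoʳ-≤-nonNeg p⁻¹ {{ℚ.nonNegative (ℚ.<⇒≤ (0<inv p 0<p))}} p≤q) ⟩
  q⁻¹ ℚ.* (q ℚ.* p⁻¹)    ≡⟨ *-swap q⁻¹ q p⁻¹ ⟩
  (q ℚ.* q⁻¹) ℚ.* p⁻¹    ≡⟨ cong (ℚ._* p⁻¹) (inv-inverseʳ q 0<q) ⟩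
  1ℚ ℚ.* p⁻¹             ≡⟨ ℚ.*-identityˡ p⁻¹ ⟩
  p⁻¹                    ∎
  where
    p⁻¹ = inv p 0<p
    q⁻¹ = inv q 0<q

toℚᵘ-recip : ∀ k → ℚ.toℚᵘ (recip k) ℚᵘ.≃ mkℚᵘ (+ 1) k
toℚᵘ-recip k = ℚ.toℚᵘ-fromℚᵘ (mkℚᵘ (+ 1) k)

recip-anti-≤ : ∀ {i j} → i ℕ.≤ j → recip j ℚ.≤ recip i
recip-anti-≤ {i} {j} i≤j = ℚ.toℚᵘ-cancel-≤
  (ℚᵘ.≤-respˡ-≃ (ℚᵘ.≃-sym (toℚᵘ-recip j)) (ℚᵘ.≤-respʳ-≃ (ℚᵘ.≃-sym (toℚᵘ-recip i))
    (ℚᵘ.*≤* (ℤ.*-monoˡ-≤-nonNeg (+ 1) (+≤+ (s≤s i≤j))))))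

0≤recip : ∀ k → 0ℚ ℚ.≤ recip k
0≤recip k = ℚ.nonNegative⁻¹ (recip k) {{ℚ.normalize-nonNeg 1 (suc k)}}

fromℕ*recip : ∀ D m k → suc k ≡ suc m ℕ.* D → fromℕℚ D ℚ.* recip k ≡ recip m
fromℕ*recip D m k eq = ℚ.toℚᵘ-injective
  (ℚᵘ.≃-trans (ℚ.toℚᵘ-homo-* (fromℕℚ D) (recip k))
  (ℚᵘ.≃-trans (ℚᵘ.*-cong (ℚ.toℚᵘ-fromℚᵘ (mkℚᵘ (+ D) 0)) (toℚᵘ-recip k))
  (ℚᵘ.≃-trans (*≡* lemma) (ℚᵘ.≃-sym (toℚᵘ-recip m)))))
  where
    lemma : (+ D ℤ.* + 1) ℤ.* + suc m
          ≡ + 1 ℤ.* + suc (k ℕ.+ 0)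
    lemma rewrite ℤ.*-identityʳ (+ D) | ℤ.*-identityˡ (+ suc (k ℕ.+ 0)) | ℕ.+-identityʳ k | eq =
      trans (sym (ℤ.pos-* D (suc m))) (cong +_ (ℕ.*-comm D (suc m)))

archimedean : ∀ δ → 0ℚ ℚ.< δ → ∃[ k ] recip k ℚ.≤ δ
archimedean δ@(mkℚ +[1+ n ] d _) _ = d , ℚ.toℚᵘ-cancel-≤ (ℚᵘ.≤-respˡ-≃ (ℚᵘ.≃-sym (toℚᵘ-recip d))
  (ℚᵘ.*≤* (ℤ.*-monoʳ-≤-nonNeg (+ suc d) {+ 1} {+ suc n} (+≤+ (s≤s z≤n)))))
archimedean (mkℚ (+ 0) _ _) (*<* (+<+ ()))
archimedean (mkℚ -[1+ _ ] _ _) (*<* ())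

-- Real numbers, as Cauchy sequences of rationals.  Sequences with the
-- same limit represent the same real and are not
-- distinguished by the orders below; _≡_ on ℝ is finer.
Cauchy : (ℕ → ℚ) → Set
Cauchy f = ∀ δ → 0ℚ ℚ.< δ → ∃[ N ] (∀ m n → N ℕ.≤ m → N ℕ.≤ n → ℚ.∣ f m ℚ.- f n ∣ ℚ.≤ δ)

record ℝ : Set where
  constructor mkℝ
  field
    seq    : ℕ → ℚ
    cauchy : Cauchy seq

open ℝ public

infix 4 _≤_ _<_

_≤_ : ℝ → ℝ → Set
x ≤ y = ∀ δ → 0ℚ ℚ.< δ → ∃[ N ] (∀ n → N ℕ.≤ n → seq x n ℚ.≤ seq y n ℚ.+ δ)

_<_ : ℝ → ℝ → Set
x < y = ∃[ δ ] (0ℚ ℚ.< δ × ∃[ N ] (∀ n → N ℕ.≤ n → seq x n ℚ.+ δ ℚ.≤ seq y n))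

cauchy-scale : ∀ f K → 0ℚ ℚ.< K →
  (∀ δ → 0ℚ ℚ.< δ → ∃[ N ] (∀ m n → N ℕ.≤ m → N ℕ.≤ n → ℚ.∣ f m ℚ.- f n ∣ ℚ.≤ K ℚ.* δ)) →
  Cauchy f
cauchy-scale f K 0<K h δ 0<δ =
  let N , close = h (inv K 0<K ℚ.* δ) (0<p*q (0<inv K 0<K) 0<δ)
  in N , λ m n N≤m N≤n → ℚ.≤-trans (close m n N≤m N≤n) (ℚ.≤-reflexive
  (trans (sym (ℚ.*-assoc K (inv K 0<K) δ))
  (trans (cong (ℚ._* δ) (inv-inverseʳ K 0<K)) (ℚ.*-identityˡ δ))))

cauchy-const : ∀ q → Cauchy (λ _ → q)
cauchy-const q δ 0<δ = 0 , λ _ _ _ _ →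
  subst (λ z → ℚ.∣ z ∣ ℚ.≤ δ) (sym (ℚ.+-inverseʳ q)) (ℚ.<⇒≤ 0<δ)

private
  0<1 : 0ℚ ℚ.< 1ℚ
  0<1 = ℚ.positive⁻¹ 1ℚ

  0<2 : 0ℚ ℚ.< 1ℚ ℚ.+ 1ℚ
  0<2 = ℚ.positive⁻¹ (1ℚ ℚ.+ 1ℚ)

cauchy-+ : ∀ f g → Cauchy f → Cauchy g → Cauchy (λ n → f n ℚ.+ g n)
cauchy-+ f g cf cg = cauchy-scale (λ n → f n ℚ.+ g n) (1ℚ ℚ.+ 1ℚ) 0<2 λ δ 0<δ →
  let N₁ , h₁ = cf δ 0<δ
      N₂ , h₂ = cg δ 0<δ
  in N₁ ℕ.⊔ N₂ , λ m n ≤m ≤n → begin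
    ℚ.∣ (f m ℚ.+ g m) ℚ.- (f n ℚ.+ g n) ∣
      ≡⟨ cong ℚ.∣_∣ (sub-+ (f m) (g m) (f n) (g n)) ⟩
    ℚ.∣ (f m ℚ.- f n) ℚ.+ (g m ℚ.- g n) ∣
      ≤⟨ ℚ.∣p+q∣≤∣p∣+∣q∣ (f m ℚ.- f n) (g m ℚ.- g n) ⟩
    ℚ.∣ f m ℚ.- f n ∣ ℚ.+ ℚ.∣ g m ℚ.- g n ∣
      ≤⟨ ℚ.+-mono-≤ (h₁ m n (ℕ.m⊔n≤o⇒m≤o N₁ N₂ ≤m) (ℕ.m⊔n≤o⇒m≤o N₁ N₂ ≤n))
                    (h₂ m n (ℕ.m⊔n≤o⇒n≤o N₁ N₂ ≤m) (ℕ.m⊔n≤o⇒n≤o N₁ N₂ ≤n)) ⟩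
    δ ℚ.+ δ
      ≡⟨ double δ ⟩
    (1ℚ ℚ.+ 1ℚ) ℚ.* δ ∎

cauchy-neg : ∀ f → Cauchy f → Cauchy (λ n → ℚ.- f n)
cauchy-neg f cf δ 0<δ =
  let N , h = cf δ 0<δ
  in N , λ m n N≤m N≤n → subst (ℚ._≤ δ)
  (trans (sym (ℚ.∣-p∣≡∣p∣ (f m ℚ.- f n))) (cong ℚ.∣_∣ (ℚ.neg-distrib-+ (f m) (ℚ.- f n))))
  (h m n N≤m N≤n)

eventually-bounded : ∀ f → Cauchy f → ∃[ B ] (0ℚ ℚ.< B × ∃[ N ] (∀ n → N ℕ.≤ n → ℚ.∣ f n ∣ ℚ.≤ B))
eventually-bounded f cf with cf 1ℚ 0<1
... | N , h = ℚ.∣ f N ∣ ℚ.+ 1ℚ , ℚ.<-≤-trans 0<1 1≤ , N , λ n N≤n → begin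
    ℚ.∣ f n ∣                         ≡⟨ cong ℚ.∣_∣ (+-sub (f n) (f N)) ⟩
    ℚ.∣ f N ℚ.+ (f n ℚ.- f N) ∣       ≤⟨ ℚ.∣p+q∣≤∣p∣+∣q∣ (f N) (f n ℚ.- f N) ⟩
    ℚ.∣ f N ∣ ℚ.+ ℚ.∣ f n ℚ.- f N ∣   ≤⟨ ℚ.+-monoʳ-≤ ℚ.∣ f N ∣ (h n N N≤n ℕ.≤-refl) ⟩
    ℚ.∣ f N ∣ ℚ.+ 1ℚ                  ∎
  where
    1≤ : 1ℚ ℚ.≤ ℚ.∣ f N ∣ ℚ.+ 1ℚ
    1≤ = subst (ℚ._≤ ℚ.∣ f N ∣ ℚ.+ 1ℚ) (ℚ.+-identityˡ 1ℚ) (ℚ.+-monoˡ-≤ 1ℚ (ℚ.0≤∣p∣ (f N)))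

private
  *-close : ∀ a b c d {A B δ} → ℚ.∣ a ∣ ℚ.≤ A → ℚ.∣ d ∣ ℚ.≤ B →
            ℚ.∣ a ℚ.- c ∣ ℚ.≤ δ → ℚ.∣ b ℚ.- d ∣ ℚ.≤ δ →
            ℚ.∣ a ℚ.* b ℚ.- c ℚ.* d ∣ ℚ.≤ (A ℚ.+ B) ℚ.* δ
  *-close a b c d {A} {B} {δ} ∣a∣≤A ∣d∣≤B a≈c b≈d = begin
    ℚ.∣ a ℚ.* b ℚ.- c ℚ.* d ∣
      ≡⟨ cong ℚ.∣_∣ (sub-* a b c d) ⟩
    ℚ.∣ a ℚ.* (b ℚ.- d) ℚ.+ (a ℚ.- c) ℚ.* d ∣
      ≤⟨ ℚ.∣p+q∣≤∣p∣+∣q∣ (a ℚ.* (b ℚ.- d)) ((a ℚ.- c) ℚ.* d) ⟩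
    ℚ.∣ a ℚ.* (b ℚ.- d) ∣ ℚ.+ ℚ.∣ (a ℚ.- c) ℚ.* d ∣
      ≡⟨ cong₂ ℚ._+_ (ℚ.∣p*q∣≡∣p∣*∣q∣ a (b ℚ.- d)) (ℚ.∣p*q∣≡∣p∣*∣q∣ (a ℚ.- c) d) ⟩
    ℚ.∣ a ∣ ℚ.* ℚ.∣ b ℚ.- d ∣ ℚ.+ ℚ.∣ a ℚ.- c ∣ ℚ.* ℚ.∣ d ∣
      ≤⟨ ℚ.+-mono-≤ (*-mono-≤ (ℚ.0≤∣p∣ a) ∣a∣≤A (ℚ.0≤∣p∣ (b ℚ.- d)) b≈d)
                    (*-mono-≤ (ℚ.0≤∣p∣ (a ℚ.- c)) a≈c (ℚ.0≤∣p∣ d) ∣d∣≤B) ⟩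
    A ℚ.* δ ℚ.+ δ ℚ.* B
      ≡⟨ factor A B δ ⟩
    (A ℚ.+ B) ℚ.* δ ∎

private
  Bounded : (ℕ → ℚ) → Set
  Bounded f = ∃[ B ] (0ℚ ℚ.< B × ∃[ N ] (∀ n → N ℕ.≤ n → ℚ.∣ f n ∣ ℚ.≤ B))

  cauchy-*-bounded : ∀ f g → Cauchy f → Cauchy g → Bounded f → Bounded g → Cauchy (λ n → f n ℚ.* g n)
  cauchy-*-bounded f g cf cg (A , 0<A , N₁ , ∣f∣≤A) (B , 0<B , N₂ , ∣g∣≤B) =
    cauchy-scale (λ n → f n ℚ.* g n) (A ℚ.+ B) (0<p+q 0<A 0<B) (λ δ 0<δ → close δ (cf δ 0<δ) (cg δ 0<δ))
    where
    module _ (δ : ℚ) where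
      Close : (ℕ → ℚ) → Set
      Close h = ∃[ N ] (∀ m n → N ℕ.≤ m → N ℕ.≤ n → ℚ.∣ h m ℚ.- h n ∣ ℚ.≤ δ)

      close : Close f → Close g → ∃[ N ] (∀ m n → N ℕ.≤ m → N ℕ.≤ n →
              ℚ.∣ f m ℚ.* g m ℚ.- f n ℚ.* g n ∣ ℚ.≤ (A ℚ.+ B) ℚ.* δ)
      close (N₃ , h₃) (N₄ , h₄) = (N₁ ℕ.⊔ N₂) ℕ.⊔ (N₃ ℕ.⊔ N₄) , λ m n ≤m ≤n →
        *-close (f m) (g m) (f n) (g n) {A} {B} {δ}
          (∣f∣≤A m (ℕ.m⊔n≤o⇒m≤o N₁ N₂ (left ≤m)))
          (∣g∣≤B n (ℕ.m⊔n≤o⇒n≤o N₁ N₂ (left ≤n)))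
          (h₃ m n (ℕ.m⊔n≤o⇒m≤o N₃ N₄ (right ≤m)) (ℕ.m⊔n≤o⇒m≤o N₃ N₄ (right ≤n)))
          (h₄ m n (ℕ.m⊔n≤o⇒n≤o N₃ N₄ (right ≤m)) (ℕ.m⊔n≤o⇒n≤o N₃ N₄ (right ≤n)))
        where
          left : ∀ {n} → (N₁ ℕ.⊔ N₂) ℕ.⊔ (N₃ ℕ.⊔ N₄) ℕ.≤ n → N₁ ℕ.⊔ N₂ ℕ.≤ n
          left = ℕ.m⊔n≤o⇒m≤o (N₁ ℕ.⊔ N₂) (N₃ ℕ.⊔ N₄)
          right : ∀ {n} → (N₁ ℕ.⊔ N₂) ℕ.⊔ (N₃ ℕ.⊔ N₄) ℕ.≤ n → N₃ ℕ.⊔ N₄ ℕ.≤ n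
          right = ℕ.m⊔n≤o⇒n≤o (N₁ ℕ.⊔ N₂) (N₃ ℕ.⊔ N₄)

cauchy-* : ∀ f g → Cauchy f → Cauchy g → Cauchy (λ n → f n ℚ.* g n)
cauchy-* f g cf cg = cauchy-*-bounded f g cf cg (eventually-bounded f cf) (eventually-bounded g cg)

private
  ⊓-close : ∀ a b c d {δ} → ℚ.∣ a ℚ.- c ∣ ℚ.≤ δ → ℚ.∣ b ℚ.- d ∣ ℚ.≤ δ → a ℚ.⊓ b ℚ.≤ c ℚ.⊓ d ℚ.+ δ
  ⊓-close a b c d {δ} a≈c b≈d = begin
    a ℚ.⊓ b                   ≤⟨ ℚ.⊓-mono-≤ {a} {c ℚ.+ δ} {b} {d ℚ.+ δ} (∣-∣≤⇒≤ a c a≈c) (∣-∣≤⇒≤ b d b≈d) ⟩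
    (c ℚ.+ δ) ℚ.⊓ (d ℚ.+ δ)   ≡⟨ ℚ.mono-≤-distrib-⊓ {λ x → x ℚ.+ δ} (ℚ.+-monoˡ-≤ δ) c d ⟨
    c ℚ.⊓ d ℚ.+ δ             ∎

cauchy-⊓ : ∀ f g → Cauchy f → Cauchy g → Cauchy (λ n → f n ℚ.⊓ g n)
cauchy-⊓ f g cf cg δ 0<δ =
  let N₁ , h₁ = cf δ 0<δ
      N₂ , h₂ = cg δ 0<δ
      close = λ m n ≤m ≤n → ⊓-close (f m) (g m) (f n) (g n)
        (h₁ m n (ℕ.m⊔n≤o⇒m≤o N₁ N₂ ≤m) (ℕ.m⊔n≤o⇒m≤o N₁ N₂ ≤n))
        (h₂ m n (ℕ.m⊔n≤o⇒n≤o N₁ N₂ ≤m) (ℕ.m⊔n≤o⇒n≤o N₁ N₂ ≤n))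
  in N₁ ℕ.⊔ N₂ , λ m n ≤m ≤n →
       ∣-∣≤ (f m ℚ.⊓ g m) (f n ℚ.⊓ g n) (close m n ≤m ≤n) (close n m ≤n ≤m)

0<p⊔δ : ∀ {δ} → 0ℚ ℚ.< δ → ∀ p → 0ℚ ℚ.< p ℚ.⊔ δ
0<p⊔δ {δ} 0<δ p = ℚ.<-≤-trans 0<δ (ℚ.p≤q⊔p p δ)

cauchy-inv : ∀ f → Cauchy f → ∀ {γ} (0<γ : 0ℚ ℚ.< γ) → Cauchy (λ n → inv (f n ℚ.⊔ γ) (0<p⊔δ 0<γ (f n)))
cauchy-inv f cf {γ} 0<γ = cauchy-scale b (c ℚ.* c) (0<p*q 0<c 0<c) λ δ 0<δ →
  let N , h = cf δ 0<δ
  in N , λ m n ≤m ≤n → begin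
    ℚ.∣ b m ℚ.- b n ∣
      ≡⟨ cong ℚ.∣_∣ (diff m n) ⟩
    ℚ.∣ (b m ℚ.* b n) ℚ.* (a n ℚ.- a m) ∣
      ≡⟨ ℚ.∣p*q∣≡∣p∣*∣q∣ (b m ℚ.* b n) (a n ℚ.- a m) ⟩
    ℚ.∣ b m ℚ.* b n ∣ ℚ.* ℚ.∣ a n ℚ.- a m ∣
      ≡⟨ cong (ℚ._* ℚ.∣ a n ℚ.- a m ∣) (ℚ.0≤p⇒∣p∣≡p (ℚ.<⇒≤ (0<p*q (0<b m) (0<b n)))) ⟩
    (b m ℚ.* b n) ℚ.* ℚ.∣ a n ℚ.- a m ∣
      ≤⟨ *-mono-≤ (ℚ.<⇒≤ (0<p*q (0<b m) (0<b n)))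
           (*-mono-≤ (ℚ.<⇒≤ (0<b m)) (b≤c m) (ℚ.<⇒≤ (0<b n)) (b≤c n))
           (ℚ.0≤∣p∣ (a n ℚ.- a m))
           (∣-∣≤ (a n) (a m) (side (f n) (f m) (ℚ.<⇒≤ 0<δ) (h n m ≤n ≤m))
                              (side (f m) (f n) (ℚ.<⇒≤ 0<δ) (h m n ≤m ≤n))) ⟩
    (c ℚ.* c) ℚ.* δ ∎
  where
    a b : ℕ → ℚ
    a n = f n ℚ.⊔ γ
    b n = inv (a n) (0<p⊔δ 0<γ (f n))
    c : ℚ
    c = inv γ 0<γ
    0<c : 0ℚ ℚ.< c
    0<c = 0<inv γ 0<γ
    0<b : ∀ n → 0ℚ ℚ.< b n
    0<b n = 0<inv (a n) (0<p⊔δ 0<γ (f n))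
    b≤c : ∀ n → b n ℚ.≤ c
    b≤c n = inv-anti-≤ 0<γ (0<p⊔δ 0<γ (f n)) (ℚ.p≤q⊔p (f n) γ)
    ab≡1 : ∀ n → a n ℚ.* b n ≡ 1ℚ
    ab≡1 n = inv-inverseʳ (a n) (0<p⊔δ 0<γ (f n))
    diff : ∀ m n → b m ℚ.- b n ≡ (b m ℚ.* b n) ℚ.* (a n ℚ.- a m)
    diff m n = begin-equality
      b m ℚ.- b n
        ≡⟨ cong₂ ℚ._-_ (ℚ.*-identityʳ (b m)) (ℚ.*-identityʳ (b n)) ⟨
      b m ℚ.* 1ℚ ℚ.- b n ℚ.* 1ℚ
        ≡⟨ cong₂ (λ u v → b m ℚ.* u ℚ.- b n ℚ.* v) (ab≡1 n) (ab≡1 m) ⟨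
      b m ℚ.* (a n ℚ.* b n) ℚ.- b n ℚ.* (a m ℚ.* b m)
        ≡⟨ sub-inv (a m) (a n) (b m) (b n) ⟩
      (b m ℚ.* b n) ℚ.* (a n ℚ.- a m) ∎
    side : ∀ p q {δ} → 0ℚ ℚ.≤ δ → ℚ.∣ p ℚ.- q ∣ ℚ.≤ δ → p ℚ.⊔ γ ℚ.≤ q ℚ.⊔ γ ℚ.+ δ
    side p q {δ} 0≤δ h = ℚ.⊔-lub
      (ℚ.≤-trans (∣-∣≤⇒≤ p q h) (ℚ.+-monoˡ-≤ δ (ℚ.p≤p⊔q q γ)))
      (ℚ.≤-trans (ℚ.≤-reflexive (sym (ℚ.+-identityʳ γ))) (ℚ.+-mono-≤ (ℚ.p≤q⊔p q γ) 0≤δ))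

infixl 6 _+_ _-_
infixl 7 _*_ _⊓_ _/_[_]
infix  8 -_

fromℚ : ℚ → ℝ
fromℚ q = mkℝ (λ _ → q) (cauchy-const q)

fromℕ : ℕ → ℝ
fromℕ n = fromℚ (fromℕℚ n)

0ℝ 1ℝ : ℝ
0ℝ = fromℚ 0ℚ
1ℝ = fromℚ 1ℚ

_+_ : ℝ → ℝ → ℝ
x + y = mkℝ (λ n → seq x n ℚ.+ seq y n) (cauchy-+ (seq x) (seq y) (cauchy x) (cauchy y))

-_ : ℝ → ℝ
- x = mkℝ (λ n → ℚ.- seq x n) (cauchy-neg (seq x) (cauchy x))

_-_ : ℝ → ℝ → ℝ
x - y = x + (- y)

_*_ : ℝ → ℝ → ℝ
x * y = mkℝ (λ n → seq x n ℚ.* seq y n) (cauchy-* (seq x) (seq y) (cauchy x) (cauchy y))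

_⊓_ : ℝ → ℝ → ℝ
x ⊓ y = mkℝ (λ n → seq x n ℚ.⊓ seq y n) (cauchy-⊓ (seq x) (seq y) (cauchy x) (cauchy y))

-- If 0 < x then x n ≥ δ > 0 for all large n, so clamping the sequence at
-- δ changes only finitely many terms while making all of them invertible.
recipℝ : (x : ℝ) → 0ℝ < x → ℝ
recipℝ x (δ , 0<δ , _) =
  mkℝ (λ n → inv (seq x n ℚ.⊔ δ) (0<p⊔δ 0<δ (seq x n))) (cauchy-inv (seq x) (cauchy x) 0<δ)

_/_[_] : (x y : ℝ) → 0ℝ < y → ℝ
x / y [ 0<y ] = x * recipℝ y 0<y

-- The natural logarithm of a positive integer, log D = ∫₁ᴰ dx/x, as the
-- limit over m of the right Riemann sums with mesh 1/m:
--   ∑_{i=1}^{m(D-1)} (1/m) · 1/(1 + i/m)  =  ∑_{i=1}^{m(D-1)} 1/(m+i),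
-- where m = n + 1 below.  (The value at D = 0 is a dummy 0.)
riemannSum : ℕ → ℕ → ℚ
riemannSum D n = sum< (suc n ℕ.* (D ℕ.∸ 1)) (λ i → + 1 ℚ./ (suc n ℕ.+ suc i))

private
  H : ℕ → ℚ
  H k = sum< k recip

  sum-cong : ∀ k {f g : ℕ → ℚ} → (∀ i → f i ≡ g i) → sum< k f ≡ sum< k g
  sum-cong zero    e = refl
  sum-cong (suc k) e = cong₂ ℚ._+_ (sum-cong k e) (e k)

  H-+ : ∀ m k → sum< k (λ i → recip (m ℕ.+ i)) ≡ H (m ℕ.+ k) ℚ.- H m
  H-+ m zero rewrite ℕ.+-identityʳ m = sym (ℚ.+-inverseʳ (H m))
  H-+ m (suc k) rewrite H-+ m k | ℕ.+-suc m k =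
    shift-sub (H (m ℕ.+ k)) (H m) (recip (m ℕ.+ k))

  fromℕℚ-suc : ∀ n → fromℕℚ (suc n) ≡ fromℕℚ n ℚ.+ 1ℚ
  fromℕℚ-suc n = ℚ.toℚᵘ-injective
    (ℚᵘ.≃-trans (ℚ.toℚᵘ-fromℚᵘ (mkℚᵘ (+ suc n) 0))
    (ℚᵘ.≃-trans (*≡* lemma)
    (ℚᵘ.≃-sym (ℚᵘ.≃-trans (ℚ.toℚᵘ-homo-+ (fromℕℚ n) 1ℚ)
      (ℚᵘ.+-cong (ℚ.toℚᵘ-fromℚᵘ (mkℚᵘ (+ n) 0)) (ℚᵘ.≃-refl {mkℚᵘ (+ 1) 0}))))))
    where
      lemma : + suc n ℤ.* + 1
            ≡ (+ n ℤ.* + 1 ℤ.+ + 1) ℤ.* + 1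
      lemma rewrite ℤ.*-identityʳ (+ suc n) | ℤ.*-identityʳ (+ n)
                  | ℤ.*-identityʳ (+ n ℤ.+ + 1) = cong +_ (ℕ.+-comm 1 n)

  suc-* : ∀ k c → fromℕℚ (suc k) ℚ.* c ≡ fromℕℚ k ℚ.* c ℚ.+ c
  suc-* k c rewrite fromℕℚ-suc k =
    *-suc (fromℕℚ k) c

  sum-upper : ∀ k {f c} → (∀ i → i ℕ.< k → f i ℚ.≤ c) → sum< k f ℚ.≤ fromℕℚ k ℚ.* c
  sum-upper zero    {c = c} h = ℚ.≤-reflexive (sym (ℚ.*-zeroˡ c))
  sum-upper (suc k) {c = c} h = ℚ.≤-trans
    (ℚ.+-mono-≤ (sum-upper k (λ i i<k → h i (ℕ.m<n⇒m<1+n i<k))) (h k ℕ.≤-refl))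
    (ℚ.≤-reflexive (sym (suc-* k c)))

  sum-lower : ∀ k {f c} → (∀ i → i ℕ.< k → c ℚ.≤ f i) → fromℕℚ k ℚ.* c ℚ.≤ sum< k f
  sum-lower zero    {c = c} h = ℚ.≤-reflexive (ℚ.*-zeroˡ c)
  sum-lower (suc k) {c = c} h = ℚ.≤-trans (ℚ.≤-reflexive (suc-* k c))
    (ℚ.+-mono-≤ (sum-lower k (λ i i<k → h i (ℕ.m<n⇒m<1+n i<k))) (h k ℕ.≤-refl))

  module _ (d : ℕ) where
    D = suc d

    R : ℕ → ℚ
    R n = riemannSum D n

    R≡ : ∀ n → R n ≡ H (suc n ℕ.* D) ℚ.- H (suc n)
    R≡ n = begin-equality
      R n
        ≡⟨ sum-cong (suc n ℕ.* d) (λ i → cong (λ j → + 1 ℚ./ suc j) (ℕ.+-suc n i)) ⟩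
      sum< (suc n ℕ.* d) (λ i → recip (suc n ℕ.+ i))
        ≡⟨ H-+ (suc n) (suc n ℕ.* d) ⟩
      H (suc n ℕ.+ suc n ℕ.* d) ℚ.- H (suc n)
        ≡⟨ cong (λ k → H k ℚ.- H (suc n)) (ℕ.*-suc (suc n) d) ⟨
      H (suc n ℕ.* D) ℚ.- H (suc n) ∎

    block : ℕ → ℚ
    block n = sum< D (λ i → recip (suc n ℕ.* D ℕ.+ i))

    step : ∀ n → R (suc n) ≡ R n ℚ.+ (block n ℚ.- recip (suc n))
    step n = begin-equality
      R (suc n)
        ≡⟨ R≡ (suc n) ⟩
      H (suc (suc n) ℕ.* D) ℚ.- H (suc (suc n))
        ≡⟨ cong (λ k → H k ℚ.- H (suc (suc n))) (ℕ.+-comm D (suc n ℕ.* D)) ⟩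
      H (suc n ℕ.* D ℕ.+ D) ℚ.- (H (suc n) ℚ.+ recip (suc n))
        ≡⟨ telescope (H (suc n ℕ.* D ℕ.+ D)) (H (suc n)) (H (suc n ℕ.* D)) (recip (suc n)) ⟩
      (H (suc n ℕ.* D) ℚ.- H (suc n)) ℚ.+ ((H (suc n ℕ.* D ℕ.+ D) ℚ.- H (suc n ℕ.* D)) ℚ.- recip (suc n))
        ≡⟨ cong₂ (λ u v → u ℚ.+ (v ℚ.- recip (suc n))) (R≡ n) (H-+ (suc n ℕ.* D) D) ⟨
      R n ℚ.+ (block n ℚ.- recip (suc n)) ∎

    block-lower : ∀ n → recip (suc n) ℚ.≤ block n
    block-lower n = ℚ.≤-trans
      (ℚ.≤-reflexive (sym (fromℕ*recip D (suc n) (suc n ℕ.* D ℕ.+ d)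
        (trans (sym (ℕ.+-suc (suc n ℕ.* D) d)) (ℕ.+-comm (suc n ℕ.* D) D)))))
      (sum-lower D (λ i i<D → recip-anti-≤ (ℕ.+-monoʳ-≤ (suc n ℕ.* D) (ℕ.≤-pred i<D))))

    block-upper : ∀ n → block n ℚ.≤ recip n
    block-upper n = ℚ.≤-trans
      (sum-upper D (λ i _ → recip-anti-≤ (ℕ.≤-trans (ℕ.n≤1+n _) (ℕ.m≤m+n (suc n ℕ.* D) i))))
      (ℚ.≤-reflexive (fromℕ*recip D n (d ℕ.+ n ℕ.* D) refl))

    R-mono-+ : ∀ N k → R N ℚ.≤ R (N ℕ.+ k)
    R-mono-+ N zero rewrite ℕ.+-identityʳ N = ℚ.≤-refl
    R-mono-+ N (suc k) = subst (λ z → R N ℚ.≤ R z) (sym (ℕ.+-suc N k)) (begin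
      R N                     ≤⟨ R-mono-+ N k ⟩
      R n                     ≡⟨ +-zero (R n) (recip (suc n)) ⟩
      R n ℚ.+ (recip (suc n) ℚ.- recip (suc n))
                              ≤⟨ ℚ.+-monoʳ-≤ (R n) (ℚ.+-monoˡ-≤ (ℚ.- recip (suc n)) (block-lower n)) ⟩
      R n ℚ.+ (block n ℚ.- recip (suc n))
                              ≡⟨ step n ⟨
      R (suc n)               ∎)
      where n = N ℕ.+ k

    R-upper-+ : ∀ N k → R (N ℕ.+ k) ℚ.+ recip (N ℕ.+ k) ℚ.≤ R N ℚ.+ recip N
    R-upper-+ N zero rewrite ℕ.+-identityʳ N = ℚ.≤-refl
    R-upper-+ N (suc k) = subst (λ z → R z ℚ.+ recip z ℚ.≤ R N ℚ.+ recip N) (sym (ℕ.+-suc N k)) (begin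
      R (suc n) ℚ.+ recip (suc n)
        ≡⟨ cong (ℚ._+ recip (suc n)) (step n) ⟩
      R n ℚ.+ (block n ℚ.- recip (suc n)) ℚ.+ recip (suc n)
        ≡⟨ sub-add (R n) (block n) (recip (suc n)) ⟩
      R n ℚ.+ block n   ≤⟨ ℚ.+-monoʳ-≤ (R n) (block-upper n) ⟩
      R n ℚ.+ recip n   ≤⟨ R-upper-+ N k ⟩
      R N ℚ.+ recip N   ∎)
      where n = N ℕ.+ k

    R-mono : ∀ {N n} → N ℕ.≤ n → R N ℚ.≤ R n
    R-mono {N} {n} N≤n = subst (λ z → R N ℚ.≤ R z) (ℕ.m+[n∸m]≡n N≤n) (R-mono-+ N (n ℕ.∸ N))

    R-upper : ∀ {N n} → N ℕ.≤ n → R n ℚ.≤ R N ℚ.+ recip N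
    R-upper {N} {n} N≤n = ℚ.≤-trans
      (ℚ.≤-trans (ℚ.≤-reflexive (sym (ℚ.+-identityʳ (R n)))) (ℚ.+-monoʳ-≤ (R n) (0≤recip n)))
      (subst (λ z → R z ℚ.+ recip z ℚ.≤ R N ℚ.+ recip N) (ℕ.m+[n∸m]≡n N≤n) (R-upper-+ N (n ℕ.∸ N)))

    R-cauchy : Cauchy R
    R-cauchy δ 0<δ =
      let N , r≤δ = archimedean δ 0<δ
      in N , λ m n N≤m N≤n → ∣-∣≤ (R m) (R n) (close r≤δ N≤m N≤n) (close r≤δ N≤n N≤m)
      where
        close : ∀ {N m n} → recip N ℚ.≤ δ → N ℕ.≤ m → N ℕ.≤ n → R m ℚ.≤ R n ℚ.+ δ
        close r≤δ N≤m N≤n = ℚ.≤-trans (R-upper N≤m) (ℚ.+-mono-≤ (R-mono N≤n) r≤δ)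

  sum-0 : ∀ n → riemannSum 0 n ≡ 0ℚ
  sum-0 n rewrite ℕ.*-zeroʳ n = refl

riemannSum-cauchy : ∀ D → Cauchy (riemannSum D)
riemannSum-cauchy (suc d) = R-cauchy d
riemannSum-cauchy zero δ 0<δ = 0 , λ m n _ _ →
  subst₂ (λ a b → ℚ.∣ a ℚ.- b ∣ ℚ.≤ δ) (sym (sum-0 m)) (sym (sum-0 n)) (ℚ.<⇒≤ 0<δ)

log : ℕ → ℝ
log D = mkℝ (riemannSum D) (riemannSum-cauchy D)

-- A finitely supported distribution, as a list of weighted outcomes; an
-- outcome may be listed several times, its weights then add up.
Dist : Set → Set
Dist A = List (ℝ × A)

return : ∀ {A} → A → Dist A
return a = [ (1ℝ , a) ]

infixl 1 _>>=_

_>>=_ : ∀ {A B} → Dist A → (A → Dist B) → Dist B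
[]            >>= k = []
((q , a) ∷ d) >>= k = map (λ (r , b) → (q * r , b)) (k a) ++ (d >>= k)

bernoulli : ℝ → Dist Bool
bernoulli q = (q , true) ∷ (1ℝ - q , false) ∷ []

𝔼 : ∀ {A} → (A → ℝ) → Dist A → ℝ
𝔼 f = foldr (λ (q , a) s → q * f a + s) 0ℝ

-- The product distribution, pushed forward along concatenation of outputs.
independently : ∀ {A} → List (Dist (List A)) → Dist (List A)
independently = foldr (λ d ds → d >>= λ xs → ds >>= λ ys → return (xs ++ ys)) (return [])

-- A document is a sequence of words, possibly with repetitions, over the
-- dictionary Fin D; `words` is the set of its distinct words.
Document : ℕ → Set
Document D = List (Fin D)

words : ∀ {D} → Document D → Subset D
words t = ⋃ (map ⁅_⁆ t)

# : ∀ {D N} → Vec (Document D) N → Fin D → ℕ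
# T w = Vec.count (λ t → w ∈? words t) T

-- An unordered pair of distinct words is represented by its increasing
-- enumeration.
pairs : ∀ {D} → Document D → List (Fin D × Fin D)
pairs {D} t = filter
  (λ (v , w) → v Fin.<? w ×-dec (v ∈? words t ×-dec w ∈? words t))
  (cartesianProduct (allFin D) (allFin D))

-- A key-value record ((v , w) → k).
Emission : ℕ → Set
Emission D = (Fin D × Fin D) × ℕ

-- 2 / n; the case n = 0 does not arise below, as the words of a pair
-- being emitted occur in some document.
2/_ : ℕ → ℚ
2/ zero  = 0ℚ
2/ suc n = + 2 ℚ./ suc n

module _ {D N : ℕ} (p ε : ℝ) (0<ε : 0ℝ < ε) (T : Vec (Document D) N) where

  emitProbability : Fin D → Fin D → ℝ
  emitProbability v w = 1ℝ ⊓ (p / ε [ 0<ε ] * fromℚ (2/ (# T v ℕ.+ # T w)))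

  diceSampleEmit : Fin D × Fin D → Dist (List (Emission D))
  diceSampleEmit (v , w) = bernoulli (emitProbability v w) >>= λ b →
    return (if b then [ ((v , w) , 1) ] else [])

  mapper : Document D → Dist (List (Emission D))
  mapper t = independently (map diceSampleEmit (pairs t))

  shuffle : Dist (List (Emission D))
  shuffle = independently (map mapper (Vec.toList T))

shuffleSize : ∀ {D} → List (Emission D) → ℝ
shuffleSize es = fromℕ (length es)

{-# OPTIONS --safe #-}

-- At every index n of the representing Cauchy sequences the weights of the
-- sampler are rationals of total mass exactly 1, so linearity of expectation
-- holds index by index and the bound is an inequality of finite rational sums:
-- with c = p/ε and 2/(#v+#w) ≤ 1/#v + 1/#w,
--   ∑_t ∑_{v,w ∈ t} c·2/(#v+#w) ≤ 2cL ∑_t ∑_{v ∈ t} 1/#v = 2cL ∑_v #v/#v ≤ 2cLD.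
module Submission where

open import Data.Bool.Base using (Bool; true; false; if_then_else_)
open import Data.Fin.Base using (Fin; zero; suc)
open import Data.Fin.Subset using (Subset; ∣_∣)
open import Data.Fin.Subset.Properties using (_∈?_)
open import Data.Integer.Base as ℤ using (+_)
import Data.Integer.Properties as ℤ
open import Data.List.Base
  using (List; []; _∷_; _++_; map; foldr; filter; length; allFin; tabulate; cartesianProduct)
import Data.List.Properties as List
open import Data.Nat.Base as ℕ using (ℕ; zero; suc)
import Data.Nat.Properties as ℕ
open import Data.Product.Base using (_×_; _,_; ∃-syntax)
open import Data.Rational.Base as ℚ using (ℚ; 0ℚ; 1ℚ)
import Data.Rational.Properties as ℚ
import Data.Rational.Solver as ℚ
open import Data.Rational.Unnormalised.Base using (mkℚᵘ; *≡*)
import Data.Rational.Unnormalised.Properties as ℚᵘ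
open import Data.Vec.Base as Vec using (Vec; []; _∷_; lookup)
open import Function.Base using (_∘_; id)
open import Level using (Level)
open import Relation.Binary.PropositionalEquality
  using (_≡_; refl; sym; trans; cong; cong₂; subst)
open import Relation.Nullary.Decidable using (does; yes; no; dec-true)
open import Relation.Unary using (Pred; Decidable)
open import Defs

open ℚ.≤-Reasoning

private
  module Q = ℚ.+-*-Solver

  variable
    ℓ : Level
    A B : Set

-- Natural numbers and fractions with a common denominator in `ℚ`

/-distribʳ-+ : ∀ m n k → (+ m ℚ./ suc k) ℚ.+ (+ n ℚ./ suc k) ≡ + (m ℕ.+ n) ℚ./ suc k
/-distribʳ-+ m n k = ℚ.toℚᵘ-injective
  (ℚᵘ.≃-trans (ℚ.toℚᵘ-homo-+ (+ m ℚ./ suc k) (+ n ℚ./ suc k))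
  (ℚᵘ.≃-trans (ℚᵘ.+-cong (ℚ.toℚᵘ-fromℚᵘ (mkℚᵘ (+ m) k)) (ℚ.toℚᵘ-fromℚᵘ (mkℚᵘ (+ n) k)))
  (ℚᵘ.≃-trans (*≡* eq) (ℚᵘ.≃-sym (ℚ.toℚᵘ-fromℚᵘ (mkℚᵘ (+ (m ℕ.+ n)) k))))))
  where
    d = + suc k
    -- The unnormalised sum of two fractions over `d` has denominator `d * d`; this is the resulting
    -- cross-multiplication.
    eq : (+ m ℤ.* d ℤ.+ + n ℤ.* d) ℤ.* d ≡ + (m ℕ.+ n) ℤ.* (d ℤ.* d)
    eq = trans (cong (ℤ._* d) (sym (ℤ.*-distribʳ-+ d (+ m) (+ n)))) (ℤ.*-assoc (+ (m ℕ.+ n)) d d)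

fromℕℚ-homo-+ : ∀ m n → fromℕℚ (m ℕ.+ n) ≡ fromℕℚ m ℚ.+ fromℕℚ n
fromℕℚ-homo-+ m n = sym (/-distribʳ-+ m n 0)

0≤fromℕℚ : ∀ n → 0ℚ ℚ.≤ fromℕℚ n
0≤fromℕℚ n = ℚ.nonNegative⁻¹ (fromℕℚ n) {{ℚ.normalize-nonNeg n 1}}

fromℕℚ-mono-≤ : ∀ {m n} → m ℕ.≤ n → fromℕℚ m ℚ.≤ fromℕℚ n
fromℕℚ-mono-≤ {m} {n} m≤n = begin
  fromℕℚ m                          ≡⟨ ℚ.+-identityʳ (fromℕℚ m) ⟨
  fromℕℚ m ℚ.+ 0ℚ                   ≤⟨ ℚ.+-monoʳ-≤ (fromℕℚ m) (0≤fromℕℚ (n ℕ.∸ m)) ⟩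
  fromℕℚ m ℚ.+ fromℕℚ (n ℕ.∸ m)     ≡⟨ fromℕℚ-homo-+ m (n ℕ.∸ m) ⟨
  fromℕℚ (m ℕ.+ (n ℕ.∸ m))          ≡⟨ cong fromℕℚ (ℕ.m+[n∸m]≡n m≤n) ⟩
  fromℕℚ n                          ∎

0≤p*q : ∀ {p q} → 0ℚ ℚ.≤ p → 0ℚ ℚ.≤ q → 0ℚ ℚ.≤ p ℚ.* q
0≤p*q {p} {q} 0≤p 0≤q =
  subst (ℚ._≤ p ℚ.* q) (ℚ.*-zeroʳ p) (ℚ.*-monoˡ-≤-nonNeg p {{ℚ.nonNegative 0≤p}} 0≤q)

-- The order on `ℝ` asks for an inequality up to each δ from some index on, so a termwise bound
-- suffices with index 0. This reduces the theorem to rational sums.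
≤-pointwise : ∀ x y → (∀ n → seq x n ℚ.≤ seq y n) → x ≤ y
≤-pointwise x y h δ 0<δ = 0 , λ n _ → begin
  seq x n          ≤⟨ h n ⟩
  seq y n          ≡⟨ ℚ.+-identityʳ (seq y n) ⟨
  seq y n ℚ.+ 0ℚ   ≤⟨ ℚ.+-monoʳ-≤ (seq y n) (ℚ.<⇒≤ 0<δ) ⟩
  seq y n ℚ.+ δ    ∎

-- Finite sums over lists

∑ : List A → (A → ℚ) → ℚ
∑ xs f = foldr (λ x s → f x ℚ.+ s) 0ℚ xs

infix 5 ∑
syntax ∑ xs (λ x → e) = ∑[ x ← xs ] e

∑-cong : ∀ {f g : A → ℚ} → (∀ x → f x ≡ g x) → ∀ xs → ∑ xs f ≡ ∑ xs g
∑-cong f≡g []       = refl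
∑-cong f≡g (x ∷ xs) = cong₂ ℚ._+_ (f≡g x) (∑-cong f≡g xs)

∑-mono-≤ : ∀ {f g : A → ℚ} → (∀ x → f x ℚ.≤ g x) → ∀ xs → ∑ xs f ℚ.≤ ∑ xs g
∑-mono-≤ f≤g []       = ℚ.≤-refl
∑-mono-≤ f≤g (x ∷ xs) = ℚ.+-mono-≤ (f≤g x) (∑-mono-≤ f≤g xs)

∑-zero : ∀ (xs : List A) → ∑ xs (λ _ → 0ℚ) ≡ 0ℚ
∑-zero []       = refl
∑-zero (x ∷ xs) = trans (ℚ.+-identityˡ _) (∑-zero xs)

∑-nonNeg : ∀ {f : A → ℚ} → (∀ x → 0ℚ ℚ.≤ f x) → ∀ xs → 0ℚ ℚ.≤ ∑ xs f
∑-nonNeg {f = f} 0≤f xs = subst (ℚ._≤ ∑ xs f) (∑-zero xs) (∑-mono-≤ {g = f} 0≤f xs)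

∑-one : ∀ (xs : List A) → ∑ xs (λ _ → 1ℚ) ≡ fromℕℚ (length xs)
∑-one []       = refl
∑-one (x ∷ xs) = trans (cong (1ℚ ℚ.+_) (∑-one xs)) (sym (fromℕℚ-homo-+ 1 (length xs)))

∑-distrib-+ : ∀ (f g : A → ℚ) xs → (∑[ x ← xs ] f x ℚ.+ g x) ≡ ∑ xs f ℚ.+ ∑ xs g
∑-distrib-+ f g []       = refl
∑-distrib-+ f g (x ∷ xs) = trans (cong (f x ℚ.+ g x ℚ.+_) (∑-distrib-+ f g xs))
  (Q.solve 4 (λ a b c d → (a Q.:+ b) Q.:+ (c Q.:+ d) Q.:= (a Q.:+ c) Q.:+ (b Q.:+ d))
    refl (f x) (g x) (∑ xs f) (∑ xs g))

*-distribˡ-∑ : ∀ c (f : A → ℚ) xs → c ℚ.* ∑ xs f ≡ (∑[ x ← xs ] c ℚ.* f x)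
*-distribˡ-∑ c f []       = ℚ.*-zeroʳ c
*-distribˡ-∑ c f (x ∷ xs) =
  trans (ℚ.*-distribˡ-+ c (f x) (∑ xs f)) (cong (c ℚ.* f x ℚ.+_) (*-distribˡ-∑ c f xs))

*-distribʳ-∑ : ∀ c (f : A → ℚ) xs → ∑ xs f ℚ.* c ≡ (∑[ x ← xs ] f x ℚ.* c)
*-distribʳ-∑ c f xs = trans (ℚ.*-comm (∑ xs f) c)
  (trans (*-distribˡ-∑ c f xs) (∑-cong (λ x → ℚ.*-comm c (f x)) xs))

∑-++ : ∀ (f : A → ℚ) xs ys → ∑ (xs ++ ys) f ≡ ∑ xs f ℚ.+ ∑ ys f
∑-++ f []       ys = sym (ℚ.+-identityˡ (∑ ys f))
∑-++ f (x ∷ xs) ys =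
  trans (cong (f x ℚ.+_) (∑-++ f xs ys)) (sym (ℚ.+-assoc (f x) (∑ xs f) (∑ ys f)))

∑-map : ∀ (h : A → B) (f : B → ℚ) xs → ∑ (map h xs) f ≡ ∑ xs (f ∘ h)
∑-map h f []       = refl
∑-map h f (x ∷ xs) = cong (f (h x) ℚ.+_) (∑-map h f xs)

∑-comm : ∀ (f : A → B → ℚ) xs ys →
         (∑[ x ← xs ] ∑[ y ← ys ] f x y) ≡ (∑[ y ← ys ] ∑[ x ← xs ] f x y)
∑-comm f []       ys = sym (∑-zero ys)
∑-comm f (x ∷ xs) ys = trans (cong (∑ ys (f x) ℚ.+_) (∑-comm f xs ys))
  (sym (∑-distrib-+ (f x) (λ y → ∑[ x ← xs ] f x y) ys))

∑-cartesianProduct : ∀ (f : A × B → ℚ) xs ys →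
                     ∑ (cartesianProduct xs ys) f ≡ (∑[ x ← xs ] ∑[ y ← ys ] f (x , y))
∑-cartesianProduct f []       ys = refl
∑-cartesianProduct f (x ∷ xs) ys =
  trans (∑-++ f (map (x ,_) ys) (cartesianProduct xs ys))
        (cong₂ ℚ._+_ (∑-map (x ,_) f ys) (∑-cartesianProduct f xs ys))

-- Discarded entries only add nonnegative terms on the right. Used to enlarge the sum over `pairs t`
-- to the full grid of word pairs.
∑-filter-≤ : ∀ {P : Pred A ℓ} (P? : Decidable P) {f g : A → ℚ} →
             (∀ x → P x → f x ℚ.≤ g x) → (∀ x → 0ℚ ℚ.≤ g x) →
             ∀ xs → ∑ (filter P? xs) f ℚ.≤ ∑ xs g
∑-filter-≤ P? f≤g 0≤g [] = ℚ.≤-refl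
∑-filter-≤ P? {f} {g} f≤g 0≤g (x ∷ xs) with P? x
... | yes px = ℚ.+-mono-≤ (f≤g x px) (∑-filter-≤ P? f≤g 0≤g xs)
... | no  _  = subst (ℚ._≤ g x ℚ.+ ∑ xs g) (ℚ.+-identityˡ _)
                 (ℚ.+-mono-≤ (0≤g x) (∑-filter-≤ P? f≤g 0≤g xs))

-- Linearity of expectation at a fixed index n of the representing sequences

module Expectation (n : ℕ) where

  E : Dist A → (A → ℚ) → ℚ
  E d f = ∑[ (q , a) ← d ] seq q n ℚ.* f a

  -- Addition and multiplication of `ℝ` act termwise, so taking the n-th term commutes with
  -- expectation.
  seq-𝔼 : ∀ (f : A → ℝ) d → seq (𝔼 f d) n ≡ E d (λ a → seq (f a) n)
  seq-𝔼 f []            = refl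
  seq-𝔼 f ((q , a) ∷ d) = cong (seq q n ℚ.* seq (f a) n ℚ.+_) (seq-𝔼 f d)

  E-cong : ∀ d {f g : A → ℚ} → (∀ a → f a ≡ g a) → E d f ≡ E d g
  E-cong d f≡g = ∑-cong (λ (q , a) → cong (seq q n ℚ.*_) (f≡g a)) d

  E-distrib-+ : ∀ d (f g : A → ℚ) → E d (λ a → f a ℚ.+ g a) ≡ E d f ℚ.+ E d g
  E-distrib-+ d f g = trans
    (∑-cong (λ (q , a) → ℚ.*-distribˡ-+ (seq q n) (f a) (g a)) d)
    (∑-distrib-+ (λ (q , a) → seq q n ℚ.* f a) (λ (q , a) → seq q n ℚ.* g a) d)

  E-return : ∀ (a : A) f → E (return a) f ≡ f a
  E-return a f = trans (ℚ.+-identityʳ _) (ℚ.*-identityˡ (f a))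

  -- Law of total expectation: weights multiply along a branch, so the outer weight factors out of
  -- the inner sum.
  E->>= : ∀ (d : Dist A) (k : A → Dist B) f → E (d >>= k) f ≡ E d (λ a → E (k a) f)
  E->>= []            k f = refl
  E->>= ((q , a) ∷ d) k f = begin-equality
    E (map (λ (r , b) → (q * r , b)) (k a) ++ (d >>= k)) f
      ≡⟨ ∑-++ weigh (map (λ (r , b) → (q * r , b)) (k a)) (d >>= k) ⟩
    E (map (λ (r , b) → (q * r , b)) (k a)) f ℚ.+ E (d >>= k) f
      ≡⟨ cong₂ ℚ._+_ (∑-map (λ (r , b) → (q * r , b)) weigh (k a)) (E->>= d k f) ⟩
    (∑[ (r , b) ← k a ] seq q n ℚ.* seq r n ℚ.* f b) ℚ.+ E d (λ a → E (k a) f)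
      ≡⟨ cong (ℚ._+ _) (∑-cong (λ (r , b) → ℚ.*-assoc (seq q n) (seq r n) (f b)) (k a)) ⟩
    (∑[ (r , b) ← k a ] seq q n ℚ.* (seq r n ℚ.* f b)) ℚ.+ E d (λ a → E (k a) f)
      ≡⟨ cong (ℚ._+ _) (*-distribˡ-∑ (seq q n) weigh (k a)) ⟨
    seq q n ℚ.* E (k a) f ℚ.+ E d (λ a → E (k a) f) ∎
    where
      weigh : ℝ × _ → ℚ
      weigh (r , b) = seq r n ℚ.* f b

  -- Total mass 1, phrased through constants because it is used to integrate out a factor on which
  -- the integrand does not depend.
  Normalised : Dist A → Set
  Normalised d = ∀ c → E d (λ _ → c) ≡ c

  normalised-return : ∀ (a : A) → Normalised (return a)
  normalised-return a c = E-return a (λ _ → c)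

  normalised->>= : ∀ {d : Dist A} {k : A → Dist B} →
                   Normalised d → (∀ a → Normalised (k a)) → Normalised (d >>= k)
  normalised->>= {d = d} {k} nd nk c =
    trans (E->>= d k (λ _ → c)) (trans (E-cong d (λ a → nk a c)) (nd c))

  -- The two weights add up to 1 exactly at each index, not merely in the limit.
  normalised-bernoulli : ∀ q → Normalised (bernoulli q)
  normalised-bernoulli q c = Q.solve 2
    (λ q c → q Q.:* c Q.:+ ((Q.con 1ℚ Q.:+ (Q.:- q)) Q.:* c Q.:+ Q.con 0ℚ) Q.:= c)
    refl (seq q n) c

  E-length : Dist (List A) → ℚ
  E-length d = E d (fromℕℚ ∘ length)

  module _ {k : B → Dist (List A)} (nk : ∀ x → Normalised (k x)) where

    normalised-independently : ∀ xs → Normalised (independently (map k xs))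
    normalised-independently []       = normalised-return {A = List A} []
    normalised-independently (x ∷ xs) =
      normalised->>= {d = k x} (nk x) λ ys →
      normalised->>= {d = independently (map k xs)} (normalised-independently xs) λ zs →
      normalised-return (ys ++ zs)

    -- Length is additive under `++`; each summand depends on one factor of the product, and the
    -- other factors integrate to 1.
    E-length-independently : ∀ xs → E-length (independently (map k xs)) ≡ ∑ xs (E-length ∘ k)
    E-length-independently []       = E-return {A = List A} [] (fromℕℚ ∘ length)
    E-length-independently (x ∷ xs) = begin-equality
      E-length (k x >>= λ ys → rest >>= λ zs → return (ys ++ zs))
        ≡⟨ E->>= (k x) _ (fromℕℚ ∘ length) ⟩
      E (k x) (λ ys → E-length (rest >>= λ zs → return (ys ++ zs)))
        ≡⟨ E-cong (k x) inner ⟩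
      E (k x) (λ ys → fromℕℚ (length ys) ℚ.+ E-length rest)
        ≡⟨ E-distrib-+ (k x) (fromℕℚ ∘ length) (λ _ → E-length rest) ⟩
      E-length (k x) ℚ.+ E (k x) (λ _ → E-length rest)
        ≡⟨ cong (E-length (k x) ℚ.+_) (trans (nk x (E-length rest)) (E-length-independently xs)) ⟩
      E-length (k x) ℚ.+ ∑ xs (E-length ∘ k) ∎
      where
        rest = independently (map k xs)
        inner : ∀ ys → E-length (rest >>= λ zs → return (ys ++ zs))
                     ≡ fromℕℚ (length ys) ℚ.+ E-length rest
        inner ys = begin-equality
          E-length (rest >>= λ zs → return (ys ++ zs))
            ≡⟨ E->>= rest _ (fromℕℚ ∘ length) ⟩
          E rest (λ zs → E-length (return (ys ++ zs)))
            ≡⟨ E-cong rest (λ zs → trans (E-return (ys ++ zs) (fromℕℚ ∘ length))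
                 (trans (cong fromℕℚ (List.length-++ ys)) (fromℕℚ-homo-+ (length ys) (length zs)))) ⟩
          E rest (λ zs → fromℕℚ (length ys) ℚ.+ fromℕℚ (length zs))
            ≡⟨ E-distrib-+ rest (λ _ → fromℕℚ (length ys)) (fromℕℚ ∘ length) ⟩
          E rest (λ _ → fromℕℚ (length ys)) ℚ.+ E-length rest
            ≡⟨ cong (ℚ._+ E-length rest) (normalised-independently xs (fromℕℚ (length ys))) ⟩
          fromℕℚ (length ys) ℚ.+ E-length rest ∎

  -- Expected output size of the sampler

  module _ {D N : ℕ} (p ε : ℝ) (0<ε : 0ℝ < ε) (T : Vec (Document D) N) where

    normalised-diceSampleEmit : ∀ vw → Normalised (diceSampleEmit p ε 0<ε T vw)
    normalised-diceSampleEmit (v , w) =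
      normalised->>= {d = bernoulli (emitProbability p ε 0<ε T v w)}
        {k = return ∘ emission} (normalised-bernoulli (emitProbability p ε 0<ε T v w)) λ b →
      normalised-return (emission b)
      where
        emission : Bool → List (Emission D)
        emission b = if b then ((v , w) , 1) ∷ [] else []

    E-length-diceSampleEmit : ∀ v w →
      E-length (diceSampleEmit p ε 0<ε T (v , w)) ≡ seq (emitProbability p ε 0<ε T v w) n
    E-length-diceSampleEmit v w = Q.solve 1
      -- In each product the middle factor 1 is the weight of `return`, and the last factor is the
      -- output length, 1 or 0.
      (λ q → q Q.:* Q.con 1ℚ Q.:* Q.con 1ℚ Q.:+
             ((Q.con 1ℚ Q.:+ (Q.:- q)) Q.:* Q.con 1ℚ Q.:* Q.con 0ℚ Q.:+ Q.con 0ℚ) Q.:= q)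
      refl (seq (emitProbability p ε 0<ε T v w) n)

    -- Additivity is applied twice: across documents, and within each mapper across its pairs.
    E-length-shuffle : E-length (shuffle p ε 0<ε T)
      ≡ (∑[ t ← Vec.toList T ] ∑[ (v , w) ← pairs t ] seq (emitProbability p ε 0<ε T v w) n)
    E-length-shuffle = trans
      (E-length-independently (normalised-independently normalised-diceSampleEmit ∘ pairs)
        (Vec.toList T))
      (∑-cong (λ t → trans
        (E-length-independently normalised-diceSampleEmit (pairs t))
        (∑-cong (λ (v , w) → E-length-diceSampleEmit v w) (pairs t))) (Vec.toList T))

-- Double counting of word occurrences

indicator : Bool → ℚ
indicator b = if b then 1ℚ else 0ℚ

0≤indicator : ∀ b → 0ℚ ℚ.≤ indicator b
0≤indicator true  = 0≤fromℕℚ 1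
0≤indicator false = ℚ.≤-refl

infix 8 _∋_

_∋_ : ∀ {D} → Subset D → Fin D → ℚ
S ∋ v = indicator (does (v ∈? S))

-- `allFin (suc D)` computes to `zero ∷ tabulate suc`; this puts the tail into the form needed for
-- induction on `D`.
∑-tabulate-suc : ∀ {D} (f : Fin (suc D) → ℚ) → ∑ (tabulate suc) f ≡ ∑ (allFin D) (f ∘ suc)
∑-tabulate-suc {D} f =
  trans (cong (λ xs → ∑ xs f) (sym (List.map-tabulate id suc))) (∑-map suc f (allFin D))

∑-∋ : ∀ {D} (S : Subset D) → (∑[ v ← allFin D ] S ∋ v) ≡ fromℕℚ ∣ S ∣
∑-∋ []          = refl
∑-∋ (true ∷ S)  = trans
  (cong (1ℚ ℚ.+_) (trans (∑-tabulate-suc ((true ∷ S) ∋_)) (∑-∋ S))) (sym (fromℕℚ-homo-+ 1 ∣ S ∣))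
∑-∋ (false ∷ S) =
  trans (ℚ.+-identityˡ _) (trans (∑-tabulate-suc ((false ∷ S) ∋_)) (∑-∋ S))

-- `#` counts by the same decision `v ∈? words t` that the indicator reads, so both sides branch on
-- one Boolean.
∑-occurrences : ∀ {D N} (T : Vec (Document D) N) v →
                (∑[ t ← Vec.toList T ] words t ∋ v) ≡ fromℕℚ (# T v)
∑-occurrences []      v = refl
∑-occurrences (t ∷ T) v with does (v ∈? words t)
... | true  = trans (cong (1ℚ ℚ.+_) (∑-occurrences T v)) (sym (fromℕℚ-homo-+ 1 (# T v)))
... | false = trans (ℚ.+-identityˡ _) (∑-occurrences T v)

-- 1/n, except that the value at n = 0 is 1; this makes 2/-≤ hold without
-- positivity assumptions.
1/_ : ℕ → ℚ
1/ n = recip (ℕ.pred n)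

-- Write 2/(a+b) as 1/(a+b) + 1/(a+b) and shrink each denominator. This splits the weight of a pair
-- into weights of single words.
2/-≤ : ∀ a b → 2/ (a ℕ.+ b) ℚ.≤ 1/ a ℚ.+ 1/ b
2/-≤ a b with a ℕ.+ b in eq
... | zero  = ℚ.+-mono-≤ (0≤recip (ℕ.pred a)) (0≤recip (ℕ.pred b))
... | suc n = begin
  + 2 ℚ./ suc n          ≡⟨ /-distribʳ-+ 1 1 n ⟨
  recip n ℚ.+ recip n    ≤⟨ ℚ.+-mono-≤
    (recip-anti-≤ (ℕ.pred-mono-≤ (subst (a ℕ.≤_) eq (ℕ.m≤m+n a b))))
    (recip-anti-≤ (ℕ.pred-mono-≤ (subst (b ℕ.≤_) eq (ℕ.m≤n+m b a)))) ⟩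
  1/ a ℚ.+ 1/ b          ∎

-- Equality for positive `n`; a word occurring in no document contributes 0.
n*1/n≤1 : ∀ n → fromℕℚ n ℚ.* (1/ n) ℚ.≤ 1ℚ
n*1/n≤1 zero    = 0≤fromℕℚ 1
n*1/n≤1 (suc n) = ℚ.≤-reflexive (fromℕ*recip (suc n) 0 n (cong suc (sym (ℕ.+-identityʳ n))))

-- After exchanging the sums, each word v is met `# T v` times with weight 1/`# T v`, hence
-- contributes at most 1 however many documents there are. Here `N` disappears.
∑-occurrences-1/# : ∀ {D N} (T : Vec (Document D) N) →
  (∑[ t ← Vec.toList T ] ∑[ v ← allFin D ] words t ∋ v ℚ.* (1/ # T v)) ℚ.≤ fromℕℚ D
∑-occurrences-1/# {D} T = begin
  (∑[ t ← Vec.toList T ] ∑[ v ← allFin D ] words t ∋ v ℚ.* (1/ # T v))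
    ≡⟨ ∑-comm (λ t v → words t ∋ v ℚ.* (1/ # T v)) (Vec.toList T) (allFin D) ⟩
  (∑[ v ← allFin D ] ∑[ t ← Vec.toList T ] words t ∋ v ℚ.* (1/ # T v))
    ≡⟨ ∑-cong (λ v → trans
         (sym (*-distribʳ-∑ (1/ # T v) (λ t → words t ∋ v) (Vec.toList T)))
         (cong (ℚ._* (1/ # T v)) (∑-occurrences T v))) (allFin D) ⟩
  (∑[ v ← allFin D ] fromℕℚ (# T v) ℚ.* (1/ # T v))
    ≤⟨ ∑-mono-≤ (λ v → n*1/n≤1 (# T v)) (allFin D) ⟩
  (∑[ v ← allFin D ] 1ℚ)
    ≡⟨ trans (∑-one (allFin D)) (cong fromℕℚ (List.length-tabulate {n = D} id)) ⟩
  fromℕℚ D ∎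

-- Enlarge the increasing pairs to all ordered pairs of words of `t`, the diagonal included. Each of
-- the two summands then factors into a free choice of one word, counted by the size of `words t`,
-- and a weighted sum over the other.
∑-pairs-≤ : ∀ {D} (t : Document D) {g : Fin D → ℚ} → (∀ v → 0ℚ ℚ.≤ g v) →
  (∑[ (v , w) ← pairs t ] g v ℚ.+ g w)
    ℚ.≤ fromℕℚ 2 ℚ.* (fromℕℚ ∣ words t ∣ ℚ.* (∑[ v ← allFin D ] words t ∋ v ℚ.* g v))
∑-pairs-≤ {D} t {g} 0≤g = begin
  (∑[ (v , w) ← pairs t ] g v ℚ.+ g w)
    ≤⟨ ∑-filter-≤ _ {g = λ (v , w) → F v w} inside
         (λ (v , w) → ℚ.+-mono-≤ (0≤p*q (0≤χ w) (0≤p*q (0≤χ v) (0≤g v)))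
                                 (0≤p*q (0≤χ v) (0≤p*q (0≤χ w) (0≤g w))))
         (cartesianProduct (allFin D) (allFin D)) ⟩
  (∑[ (v , w) ← cartesianProduct (allFin D) (allFin D) ] F v w)
    ≡⟨ ∑-cartesianProduct (λ (v , w) → F v w) (allFin D) (allFin D) ⟩
  (∑[ v ← allFin D ] ∑[ w ← allFin D ] F v w)
    ≡⟨ ∑-cong (λ v → ∑-distrib-+ (λ w → χ w ℚ.* (χ v ℚ.* g v)) (λ w → χ v ℚ.* (χ w ℚ.* g w)) (allFin D))
         (allFin D) ⟩
  (∑[ v ← allFin D ] (∑[ w ← allFin D ] χ w ℚ.* (χ v ℚ.* g v)) ℚ.+ (∑[ w ← allFin D ] χ v ℚ.* (χ w ℚ.* g w)))
    ≡⟨ ∑-cong (λ v → cong₂ ℚ._+_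
         (trans (sym (*-distribʳ-∑ (χ v ℚ.* g v) χ (allFin D))) (cong (ℚ._* (χ v ℚ.* g v)) (∑-∋ S)))
         (sym (*-distribˡ-∑ (χ v) (λ w → χ w ℚ.* g w) (allFin D)))) (allFin D) ⟩
  (∑[ v ← allFin D ] s ℚ.* (χ v ℚ.* g v) ℚ.+ χ v ℚ.* G)
    ≡⟨ ∑-distrib-+ (λ v → s ℚ.* (χ v ℚ.* g v)) (λ v → χ v ℚ.* G) (allFin D) ⟩
  (∑[ v ← allFin D ] s ℚ.* (χ v ℚ.* g v)) ℚ.+ (∑[ v ← allFin D ] χ v ℚ.* G)
    ≡⟨ cong₂ ℚ._+_ (sym (*-distribˡ-∑ s (λ v → χ v ℚ.* g v) (allFin D)))
         (trans (sym (*-distribʳ-∑ G χ (allFin D))) (cong (ℚ._* G) (∑-∋ S))) ⟩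
  s ℚ.* G ℚ.+ s ℚ.* G
    ≡⟨ Q.solve 1 (λ x → x Q.:+ x Q.:= Q.con (fromℕℚ 2) Q.:* x) refl (s ℚ.* G) ⟩
  fromℕℚ 2 ℚ.* (s ℚ.* G) ∎
  where
    S = words t
    χ : Fin D → ℚ
    χ v = S ∋ v
    0≤χ : ∀ v → 0ℚ ℚ.≤ χ v
    0≤χ v = 0≤indicator (does (v ∈? S))
    s = fromℕℚ ∣ S ∣
    G = ∑[ v ← allFin D ] χ v ℚ.* g v
    -- Both indicators multiply each summand, so `F` is `g v + g w` on pairs from `S` and 0
    -- elsewhere. The indicator of the unweighted word stands outside, ready to be summed to `s`.
    F : Fin D → Fin D → ℚ
    F v w = χ w ℚ.* (χ v ℚ.* g v) ℚ.+ χ v ℚ.* (χ w ℚ.* g w)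
    inside : ∀ ((v , w) : Fin D × Fin D) → _ → g v ℚ.+ g w ℚ.≤ F v w
    inside (v , w) (_ , v∈S , w∈S)
      rewrite dec-true (v ∈? S) v∈S | dec-true (w ∈? S) w∈S = ℚ.≤-reflexive
        (Q.solve 2 (λ a b → a Q.:+ b Q.:=
           Q.con 1ℚ Q.:* (Q.con 1ℚ Q.:* a) Q.:+ Q.con 1ℚ Q.:* (Q.con 1ℚ Q.:* b)) refl (g v) (g w))

-- Here the bound `L` on distinct words per document enters; nonnegative `g` lets it replace each
-- size.
∑-documents-≤ : ∀ {D L N} (T : Vec (Document D) N) →
  (∀ i → ∣ words (lookup T i) ∣ ℕ.≤ L) → {g : Document D → ℚ} → (∀ t → 0ℚ ℚ.≤ g t) →
  (∑[ t ← Vec.toList T ] fromℕℚ ∣ words t ∣ ℚ.* g t) ℚ.≤ fromℕℚ L ℚ.* (∑[ t ← Vec.toList T ] g t)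
∑-documents-≤ {L = L} []      _   _   = ℚ.≤-reflexive (sym (ℚ.*-zeroʳ (fromℕℚ L)))
∑-documents-≤ {L = L} (t ∷ T) ≤L {g} 0≤g = begin
  fromℕℚ ∣ words t ∣ ℚ.* g t ℚ.+ (∑[ t ← Vec.toList T ] fromℕℚ ∣ words t ∣ ℚ.* g t)
    ≤⟨ ℚ.+-mono-≤ (ℚ.*-monoʳ-≤-nonNeg (g t) {{ℚ.nonNegative (0≤g t)}} (fromℕℚ-mono-≤ (≤L zero)))
                  (∑-documents-≤ T (≤L ∘ suc) 0≤g) ⟩
  fromℕℚ L ℚ.* g t ℚ.+ fromℕℚ L ℚ.* ∑ (Vec.toList T) g
    ≡⟨ ℚ.*-distribˡ-+ (fromℕℚ L) (g t) (∑ (Vec.toList T) g) ⟨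
  fromℕℚ L ℚ.* (g t ℚ.+ ∑ (Vec.toList T) g) ∎

-- The deterministic core: the 2 comes from enlarging to ordered pairs, `L` from the document sizes,
-- and `D` from the double count.
∑-2/-≤ : ∀ {D L N} (T : Vec (Document D) N) → (∀ i → ∣ words (lookup T i) ∣ ℕ.≤ L) →
  (∑[ t ← Vec.toList T ] ∑[ (v , w) ← pairs t ] 2/ (# T v ℕ.+ # T w))
    ℚ.≤ fromℕℚ 2 ℚ.* (fromℕℚ L ℚ.* fromℕℚ D)
∑-2/-≤ {D} {L} T ≤L = begin
  (∑[ t ← docs ] ∑[ (v , w) ← pairs t ] 2/ (# T v ℕ.+ # T w))
    ≤⟨ ∑-mono-≤ (λ t → ∑-mono-≤ (λ (v , w) → 2/-≤ (# T v) (# T w)) (pairs t)) docs ⟩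
  (∑[ t ← docs ] ∑[ (v , w) ← pairs t ] (1/ # T v) ℚ.+ (1/ # T w))
    ≤⟨ ∑-mono-≤ (λ t → ∑-pairs-≤ t 0≤1/#) docs ⟩
  (∑[ t ← docs ] fromℕℚ 2 ℚ.* (fromℕℚ ∣ words t ∣ ℚ.* G t))
    ≡⟨ *-distribˡ-∑ (fromℕℚ 2) (λ t → fromℕℚ ∣ words t ∣ ℚ.* G t) docs ⟨
  fromℕℚ 2 ℚ.* (∑[ t ← docs ] fromℕℚ ∣ words t ∣ ℚ.* G t)
    ≤⟨ ℚ.*-monoˡ-≤-nonNeg (fromℕℚ 2) (ℚ.≤-trans
         (∑-documents-≤ T ≤L {G} λ t →
           ∑-nonNeg (λ v → 0≤p*q (0≤indicator (does (v ∈? words t))) (0≤1/# v)) (allFin D))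
         (ℚ.*-monoˡ-≤-nonNeg (fromℕℚ L) {{ℚ.nonNegative (0≤fromℕℚ L)}} (∑-occurrences-1/# T))) ⟩
  fromℕℚ 2 ℚ.* (fromℕℚ L ℚ.* fromℕℚ D) ∎
  where
    docs = Vec.toList T
    0≤1/# : ∀ v → 0ℚ ℚ.≤ 1/ # T v
    0≤1/# v = 0≤recip (ℕ.pred (# T v))
    G : Document D → ℚ
    G t = ∑[ v ← allFin D ] words t ∋ v ℚ.* (1/ # T v)

-- Nonnegativity of the logarithm's approximations and the final estimate

0≤sum< : ∀ k {f} → (∀ i → 0ℚ ℚ.≤ f i) → 0ℚ ℚ.≤ sum< k f
0≤sum< zero    0≤f = ℚ.≤-refl
0≤sum< (suc k) 0≤f = ℚ.+-mono-≤ (0≤sum< k 0≤f) (0≤f k)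

-- Needed at every index, since the combinatorial bound is multiplied by the n-th term of p/ε.
0≤riemannSum : ∀ D n → 0ℚ ℚ.≤ riemannSum D n
0≤riemannSum D n = 0≤sum< (suc n ℕ.* (D ℕ.∸ 1)) (λ i → 0≤recip (n ℕ.+ suc i))

theorem9 : ∃[ C ] ((D L N : ℕ) → 2 ℕ.≤ D →
    (T : Vec (Document D) N) → (∀ i → ∣ words (lookup T i) ∣ ℕ.≤ L) →
    (ε : ℝ) (0<ε : 0ℝ < ε) → ε ≤ 1ℝ →
    𝔼 shuffleSize (shuffle (fromℕ 2 * log D) ε 0<ε T)
    ≤ C * (fromℕ D * fromℕ L * log D / ε [ 0<ε ]))
-- The constant 4 is the 2 in p = 2 log D times the 2 in `∑-2/-≤`. Matching on `0<ε` exposes the δ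
-- at which `recipℝ` clamps.
theorem9 = fromℕ 4 , λ D L N _ T ≤L ε 0<ε@(δ , 0<δ , _) _ → ≤-pointwise
  (𝔼 shuffleSize (shuffle (fromℕ 2 * log D) ε 0<ε T))
  (fromℕ 4 * (fromℕ D * fromℕ L * log D / ε [ 0<ε ])) λ n →
  let open Expectation n
      p    = fromℕ 2 * log D
      docs = Vec.toList T
      r    = riemannSum D n
      -- The n-th term of `recipℝ ε 0<ε`, positive at every index thanks to the clamp; `c` is thus
      -- the n-th term of p/ε.
      e    = inv (seq ε n ℚ.⊔ δ) (0<p⊔δ 0<δ (seq ε n))
      c    = fromℕℚ 2 ℚ.* r ℚ.* e
      2/#  = λ (v , w) → 2/ (# T v ℕ.+ # T w)
      0≤c  = 0≤p*q (0≤p*q (0≤fromℕℚ 2) (0≤riemannSum D n))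
                   (ℚ.<⇒≤ (0<inv (seq ε n ℚ.⊔ δ) (0<p⊔δ 0<δ (seq ε n))))
  in begin
    seq (𝔼 shuffleSize (shuffle p ε 0<ε T)) n
      ≡⟨ seq-𝔼 shuffleSize (shuffle p ε 0<ε T) ⟩
    E-length (shuffle p ε 0<ε T)
      ≡⟨ E-length-shuffle p ε 0<ε T ⟩
    (∑[ t ← docs ] ∑[ (v , w) ← pairs t ] seq (emitProbability p ε 0<ε T v w) n)
      -- The cap at 1 in the emission probability is dropped.
      ≤⟨ ∑-mono-≤ (λ t → ∑-mono-≤ (λ vw → ℚ.p⊓q≤q 1ℚ (c ℚ.* 2/# vw)) (pairs t)) docs ⟩
    (∑[ t ← docs ] ∑[ vw ← pairs t ] c ℚ.* 2/# vw)
      ≡⟨ ∑-cong (λ t → *-distribˡ-∑ c 2/# (pairs t)) docs ⟨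
    (∑[ t ← docs ] c ℚ.* ∑ (pairs t) 2/#)
      ≡⟨ *-distribˡ-∑ c (λ t → ∑ (pairs t) 2/#) docs ⟨
    c ℚ.* (∑[ t ← docs ] ∑ (pairs t) 2/#)
      ≤⟨ ℚ.*-monoˡ-≤-nonNeg c {{ℚ.nonNegative 0≤c}} (∑-2/-≤ T ≤L) ⟩
    c ℚ.* (fromℕℚ 2 ℚ.* (fromℕℚ L ℚ.* fromℕℚ D))
      ≡⟨ Q.solve 4 (λ r e l d →
           Q.con (fromℕℚ 2) Q.:* r Q.:* e Q.:* (Q.con (fromℕℚ 2) Q.:* (l Q.:* d)) Q.:=
           Q.con (fromℕℚ 4) Q.:* (d Q.:* l Q.:* r Q.:* e))
           refl r e (fromℕℚ L) (fromℕℚ D) ⟩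
    fromℕℚ 4 ℚ.* (fromℕℚ D ℚ.* fromℕℚ L ℚ.* r ℚ.* e) ∎
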